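{- Let $\mathcal{L}\subseteq\mathrm{Scat}$ be nonempty, downward $\preceq$-closed and ccs. Then the quasi-order $\trianglelefteq^{\mathcal{L}}_{\mathrm{LO}}$ does not have maximal elements, and every dominating family with respect to $\trianglelefteq^{\mathcal{L}}_{\mathrm{LO}}$ has size $2^{\aleph_0}$. Thus $\mathfrak{d}(\trianglelefteq^{\mathcal{L}}_{\mathrm{LO}})=2^{\aleph_0}$.
   Context: Linear orders are reflexive and nonempty. $L\preceq L'$ means there is an embedding $f:L\to L'$, i.e. $x\le_L y\iff f(x)\le_{L'}f(y)$. $\mathrm{LO}\subseteq 2^{\mathbb{N}\times\mathbb{N}}$ is the set of (codes for) linear orders with domain $\mathbb{N}$; $\mathrm{Fin}$ is the set of (codes for) nonempty linear orders on finite subsets of $\mathbb{N}$; $\mathrm{Lin}=\mathrm{Fin}\cup\mathrm{LO}$; $\mathrm{Scat}\subseteq\mathrm{Lin}$ is the set of scattered ones (those $L$ with $\mathbb{Q}\not\preceq L$). A class $\mathcal{L}\subseteq\mathrm{Lin}$ is downward $\preceq$-closed if $K\in\mathrm{Lin}$ and $K\preceq L\in\mathcal{L}$ imply $K\in\mathcal{L}$; membership in $\mathcal{L}$ is meant up to isomorphism. A subset $I$ of a linear order $L$ is convex if $x\le_L y\le_L z$ and $x,z\in I$ imply $y\in I$. For $A,B\subseteq L$ write $A\le_L B$ (resp. $A<_L B$) if $a\le_L b$ (resp. $a<_L b$) for all $a\in A$, $b\in B$. A $K$-convex partition of $L$ is a partition $(L_k)_{k\in K}$ of $L$ (into nonempty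 sets) such that $k<_K k'\iff L_k<_L L_{k'}$. The relation $L\trianglelefteq^{\mathcal{L}}L'$ holds iff there are $K\in\mathcal{L}$, a $K$-convex partition $(L_k)_{k\in K}$ of $L$, and an embedding $f$ of $L$ into $L'$ such that $f(L_k)$ is a convex subset of $L'$ for every $k\in K$. $\trianglelefteq^{\mathcal{L}}_{\mathrm{LO}}$ is its restriction to $\mathrm{LO}$. $\mathcal{L}$ is ccs (closed under convex sums) if for all $K,K'\in\mathcal{L}$ and every family $(K'_k)_{k\in K}$ of nonempty convex subsets of $K'$ such that $k_0<_K k_1\Rightarrow K'_{k_0}\le_{K'}K'_{k_1}$, we have $\sum_{k\in K}K'_k\in\mathcal{L}$, where $\sum_{k\in K}K'_k=\{(x,k): k\in K, x\in K'_k\}$ ordered antilexicographically. When $\mathcal{L}$ is ccs, $\trianglelefteq^{\mathcal{L}}$ is a quasi-order. For a quasi-order $\precsim$ on $X$: $x$ is maximal if there is no $y\in X$ with $x\precsim y$ and $y\not\precsim x$; $\mathcal{F}\subseteq X$ is a dominating family if for every $x\in X$ there is $y\in\mathcal{F}$ with $x\precsim y$; the dominating number $\mathfrak{d}(\precsim)$ is the least size of a dominating family. -}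

module Defs where

open import Data.Bool using (Bool; T)
open import Data.Bool.Properties using (T-irrelevant)
open import Data.List using (List)
import Data.List.Membership.Propositional as List
open import Data.Nat using (ℕ)
import Data.Nat.Properties as ℕ
open import Data.Product using (Σ; ∃; _×_; _,_; proj₁; proj₂; swap)
open import Data.Product.Properties using (≡-dec)
open import Data.Product.Relation.Binary.Lex.NonStrict using (×-isTotalOrder)
import Data.Rational.Properties as ℚ
open import Data.Sum using (inj₁; inj₂)
open import Function using (_∘_; _⇔_)
open import Function.Bundles using (Bijection; Injection)
open import Level using (0ℓ; suc; Level)
open import Relation.Binary using (Rel; Setoid; TotalOrder; DecTotalOrder; IsTotalOrder; DecidableEquality)
import Relation.Binary.Construct.NonStrictToStrict as ToStrict
import Relation.Binary.Construct.On as On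
open import Relation.Binary.Morphism.Structures using (IsOrderMonomorphism; IsOrderIsomorphism)
open import Relation.Binary.PropositionalEquality using (_≡_; _→-setoid_)
open import Relation.Nullary using (¬_; yes)
open import Relation.Unary using (Pred; _∈_; _∪_; Satisfiable; Universal)

private
  variable
    a ℓ : Level

LinearOrder : Set₁
LinearOrder = TotalOrder 0ℓ 0ℓ 0ℓ

module _ (L L′ : LinearOrder) where
  private
    module L  = TotalOrder L
    module L′ = TotalOrder L′

  -- x ≤ y ⇔ f x ≤ f y, given by the fields `mono` and `cancel`; for partial
  -- orders the remaining two fields follow from these.
  IsEmbedding : (L.Carrier → L′.Carrier) → Set
  IsEmbedding = IsOrderMonomorphism L._≈_ L′._≈_ L._≤_ L′._≤_

  infix 4 _≼_ _≅_

  _≼_ : Set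
  _≼_ = ∃ IsEmbedding

  _≅_ : Set
  _≅_ = ∃ (IsOrderIsomorphism L._≈_ L′._≈_ L._≤_ L′._≤_)

module _ (L : LinearOrder) where
  open TotalOrder L

  Strict : Rel Carrier 0ℓ
  Strict = ToStrict._<_ _≈_ _≤_

  Convex : Pred (Pred Carrier 0ℓ) 0ℓ
  Convex I = ∀ {x y z} → x ≤ y → y ≤ z → x ∈ I → z ∈ I → y ∈ I

  SetLe : Rel (Pred Carrier 0ℓ) 0ℓ
  SetLe A B = ∀ {a b} → a ∈ A → b ∈ B → a ≤ b

  SetLt : Rel (Pred Carrier 0ℓ) 0ℓ
  SetLt A B = ∀ {a b} → a ∈ A → b ∈ B → Strict a b

-- A code is the characteristic function of a binary relation on ℕ. The domain
-- of a reflexive relation is recovered from its diagonal.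
Code : Set
Code = ℕ × ℕ → Bool

dom : Code → Pred ℕ 0ℓ
dom r n = T (r (n , n))

Elem : Code → Set
Elem r = ∃ (dom r)

CodeLe : (r : Code) → Rel (Elem r) 0ℓ
CodeLe r x y = T (r (proj₁ x , proj₁ y))

record IsLinear (r : Code) : Set where
  field
    supported    : ∀ {m n} → T (r (m , n)) → m ∈ dom r × n ∈ dom r
    isTotalOrder : IsTotalOrder _≡_ (CodeLe r)

Finite : Pred (Pred ℕ 0ℓ) 0ℓ
Finite A = ∃ λ (xs : List ℕ) → ∀ {n} → n ∈ A → n List.∈ xs

Fin LO Lin : Pred Code 0ℓ
Fin r = IsLinear r × Finite (dom r) × Satisfiable (dom r)
LO  r = IsLinear r × Universal (dom r)
Lin   = Fin ∪ LO

LO⇒Lin : ∃ LO → ∃ Lin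
LO⇒Lin (r , p) = r , inj₂ p

isLinear : (L : ∃ Lin) → IsLinear (proj₁ L)
isLinear (r , inj₁ p) = proj₁ p
isLinear (r , inj₂ p) = proj₁ p

order : ∃ Lin → LinearOrder
order L = record { isTotalOrder = IsLinear.isTotalOrder (isLinear L) }

∣_∣ : ∃ Lin → Set
∣ L ∣ = TotalOrder.Carrier (order L)

Scat : Pred (∃ Lin) 0ℓ
Scat L = ¬ (DecTotalOrder.totalOrder ℚ.≤-decTotalOrder ≼ order L)

DownwardClosed : Pred (Pred (∃ Lin) 0ℓ) 0ℓ
DownwardClosed 𝓛 = ∀ {K L} → order K ≼ order L → L ∈ 𝓛 → K ∈ 𝓛

Elem-≟ : (r : Code) → DecidableEquality (Elem r)
Elem-≟ r = ≡-dec ℕ._≟_ (λ p q → yes (T-irrelevant p q))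

-- The elements are the pairs (x , k) with x in the k-th summand; they are
-- compared by k first, and equality ignores the membership proof.
convexSum : (K K′ : ∃ Lin) → (∣ K ∣ → Pred ∣ K′ ∣ 0ℓ) → LinearOrder
convexSum K K′ A = record
  { Carrier      = Σ (∣ K′ ∣ × ∣ K ∣) (λ (x , k) → x ∈ A k)
  ; isTotalOrder = On.isTotalOrder (swap ∘ proj₁)
      (×-isTotalOrder (Elem-≟ (proj₁ K))
        (TotalOrder.isTotalOrder (order K))
        (TotalOrder.isTotalOrder (order K′)))
  }

-- A class of codes contains an arbitrary linear order when it contains a code
-- isomorphic to it.
_∈≅_ : LinearOrder → Pred (∃ Lin) 0ℓ → Set
M ∈≅ 𝓛 = ∃ λ L → L ∈ 𝓛 × order L ≅ M

CCS : Pred (Pred (∃ Lin) 0ℓ) (suc 0ℓ)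
CCS 𝓛 = ∀ {K K′} → K ∈ 𝓛 → K′ ∈ 𝓛 →
  (A : ∣ K ∣ → Pred ∣ K′ ∣ 0ℓ) →
  (∀ k → Satisfiable (A k)) →
  (∀ k → Convex (order K′) (A k)) →
  (∀ {k₀ k₁} → Strict (order K) k₀ k₁ → SetLe (order K′) (A k₀) (A k₁)) →
  convexSum K K′ A ∈≅ 𝓛

record IsConvexPartition (K L : ∃ Lin) (P : ∣ K ∣ → Pred ∣ L ∣ 0ℓ) : Set where
  field
    nonempty : ∀ k → Satisfiable (P k)
    covers   : ∀ x → ∃ λ k → x ∈ P k
    disjoint : ∀ {k k′ x} → x ∈ P k → x ∈ P k′ → k ≡ k′
    ordered  : ∀ {k k′} → Strict (order K) k k′ ⇔ SetLt (order L) (P k) (P k′)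

image : {A B : Set} → (A → B) → Pred A 0ℓ → Pred B 0ℓ
image f P y = ∃ λ x → x ∈ P × f x ≡ y

PiecewiseConvex : Pred (∃ Lin) 0ℓ → Rel (∃ Lin) (suc 0ℓ)
PiecewiseConvex 𝓛 L L′ =
  ∃ λ K → K ∈ 𝓛 ×
  ∃ λ (P : ∣ K ∣ → Pred ∣ L ∣ 0ℓ) → IsConvexPartition K L P ×
  ∃ λ (f : ∣ L ∣ → ∣ L′ ∣) → IsEmbedding (order L) (order L′) f ×
  (∀ k → Convex (order L′) (image f (P k)))

PiecewiseConvexLO : Pred (∃ Lin) 0ℓ → Rel (∃ LO) (suc 0ℓ)
PiecewiseConvexLO 𝓛 L L′ = PiecewiseConvex 𝓛 (LO⇒Lin L) (LO⇒Lin L′)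

module _ {X : Set a} (_≲_ : Rel X ℓ) where

  Maximal : Pred X _
  Maximal x = ¬ (∃ λ y → x ≲ y × ¬ (y ≲ x))

  Dominating : Pred (Pred X 0ℓ) _
  Dominating F = ∀ x → ∃ λ y → y ∈ F × x ≲ y

-- Cardinalities are compared between setoids, so that sets of codes are counted
-- up to equality of the codes, ignoring the proofs attached to them.
2^ℕ : Setoid 0ℓ 0ℓ
2^ℕ = ℕ →-setoid Bool

LO-setoid : Setoid 0ℓ 0ℓ
LO-setoid = On.setoid ((ℕ × ℕ) →-setoid Bool) (proj₁ {B = LO})

subset : (X : Setoid 0ℓ 0ℓ) → Pred (Setoid.Carrier X) 0ℓ → Setoid 0ℓ 0ℓ
subset X F = On.setoid X (proj₁ {B = F})

record DominatingNumberIs (X : Setoid 0ℓ 0ℓ) (_≲_ : Rel (Setoid.Carrier X) (suc 0ℓ))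
                          (κ : Setoid 0ℓ 0ℓ) : Set (suc 0ℓ) where
  field
    attained : ∃ λ F → Dominating _≲_ F × Bijection (subset X F) κ
    least    : ∀ F → Dominating _≲_ F → Injection κ (subset X F)

{-# OPTIONS --safe #-}
module Submission where

-- To a subset x of ℕ attach a scattered order, the block of x, which is the
-- sum over n of ω + ζ or 1 + ζ according to whether n lies in x. The starts of
-- its cells are exactly its limit points (points without immediate
-- predecessor), and n lies in x if and only if the n-th start has an immediate
-- successor. These properties survive convex embeddings, so a convex copy of
-- the block inside an order M can be decoded from its first point alone
-- (decode).
--
-- Let the extension of L by x be L followed by ℚ many copies of the block. It
-- lies above L. Suppose that it lies below M, and consider the pieces containing
-- the first points of the copies. As the order indexing the partition is
-- scattered, two of these first points lie in one piece, so that this piece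
-- contains a whole block, which is therefore mapped convexly into M (readable).
-- Hence x is determined by M together with one point of M, and M lies above
-- only countably many of the extensions of L.
--
-- If a set F of orders bounds all the extensions of L, then choosing a bound and
-- a point gives an injection of the continuum into F × ℕ, and a diagonal argument
-- removes the factor ℕ (drop-label, bounds-large). Applied with F consisting
-- of L alone, this shows that L is not maximal; applied to a dominating family, it
-- shows together with the Cantor-Schröder-Bernstein theorem that the family
-- has the size of the continuum.

open import Defs
open import Axiom.ExcludedMiddle using (ExcludedMiddle)
open import Axiom.Extensionality.Propositional using (Extensionality)
open import Data.Bool using (Bool; true; false; T; f<t)
import Data.Bool.Properties as Bool
import Data.Fin as Fin
import Data.Fin.Properties as Fin
open import Data.Integer as ℤ using (ℤ; +_; -[1+_]; 0ℤ)
import Data.Integer.Properties as ℤ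
open import Data.List using ([]; _∷_)
open import Data.List.Relation.Unary.Any using (here)
open import Data.Nat using (ℕ; zero; suc; _+_; _*_; _≤_; s≤s; z<s)
import Data.Nat.Properties as ℕ
open import Data.Product using (Σ; ∃; _×_; _,_; proj₁; proj₂; uncurry)
open import Data.Rational using (ℚ; mkℚ)
import Data.Rational.Properties as ℚ
open import Data.Sum using (_⊎_; inj₁; inj₂)
open import Data.Unit using (⊤; tt)
open import Function using (_∘_; id; const; case_of_; _↣_; mk↣; _⇔_; mk⇔; Equivalence)
open import Function.Bundles using (Bijection; Injection)
open import Level as Level using (0ℓ; Lift; lift; lower)
open import Relation.Binary
  using ( Rel; Setoid; TotalOrder; IsTotalOrder; IsStrictTotalOrder; DecidableEquality
        ; Trichotomous; tri<; tri≈; tri>)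
import Relation.Binary.Construct.NonStrictToStrict as ToStrict
open import Relation.Binary.Morphism.Structures using (IsOrderMonomorphism)
open import Relation.Binary.PropositionalEquality
  using ( _≡_; refl; sym; trans; cong; cong-app; subst; subst₂; setoid; isEquivalence; resp₂
        ; module ≡-Reasoning)
open import Relation.Nullary using (¬_; yes; no; ¬?; ⌊_⌋; toWitness; fromWitness; contradiction)
open import Relation.Nullary.Decidable using (map′; decidable-stable)
open import Relation.Unary using (Pred; _∈_; _⊆_; Satisfiable; U)

-- Injections into ℕ

-- An injective pairing: the square of m + n, shifted by m ≤ m + n, determines
-- m + n and then m.
pair : ℕ → ℕ → ℕ
pair m n = (m + n) * (m + n) + m

private
  pair-sum≤ : ∀ m n m′ n′ → pair m n ≡ pair m′ n′ → m′ + n′ ≤ m + n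
  pair-sum≤ m n m′ n′ eq = ℕ.≮⇒≥ λ s<s′ → ℕ.<-irrefl eq (begin-strict
    s * s + m              ≤⟨ ℕ.+-monoʳ-≤ (s * s) (ℕ.m≤m+n m n) ⟩
    s * s + s              ≡⟨ ℕ.+-comm (s * s) s ⟩
    suc s * s              <⟨ ℕ.*-monoʳ-< (suc s) (ℕ.n<1+n s) ⟩
    suc s * suc s          ≤⟨ ℕ.*-mono-≤ s<s′ s<s′ ⟩
    s′ * s′                ≤⟨ ℕ.m≤m+n (s′ * s′) m′ ⟩
    s′ * s′ + m′           ∎)
    where
    open ℕ.≤-Reasoning
    s s′ : ℕ
    s  = m + n
    s′ = m′ + n′

pair-injective : ∀ m n m′ n′ → pair m n ≡ pair m′ n′ → m ≡ m′ × n ≡ n′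
pair-injective m n m′ n′ eq = m≡m′ , n≡n′
  where
  sum≡ : m + n ≡ m′ + n′
  sum≡ = ℕ.≤-antisym (pair-sum≤ m′ n′ m n (sym eq)) (pair-sum≤ m n m′ n′ eq)

  m≡m′ : m ≡ m′
  m≡m′ = ℕ.+-cancelˡ-≡ ((m + n) * (m + n)) m m′
    (trans eq (cong (λ s → s * s + m′) (sym sum≡)))

  n≡n′ : n ≡ n′
  n≡n′ = ℕ.+-cancelˡ-≡ m n n′ (trans sum≡ (cong (_+ n′) (sym m≡m′)))

Σ↣ℕ : {A : Set} {B : A → Set} → A ↣ ℕ → (∀ a → B a ↣ ℕ) → Σ A B ↣ ℕ
Σ↣ℕ {A} {B} i j = mk↣ injective
  where
  module I = Injection i
  module J a = Injection (j a)

  code : Σ A B → ℕ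
  code (a , b) = pair (I.to a) (J.to a b)

  injective : ∀ {p q} → code p ≡ code q → p ≡ q
  injective {a , b} {a′ , b′} eq
    with i≡ , j≡ ← pair-injective (I.to a) _ (I.to a′) _ eq
    with refl ← I.injective i≡ = cong (a ,_) (J.injective a j≡)

Bool↣ℕ : Bool ↣ ℕ
Bool↣ℕ = mk↣ {to = λ { false → 0 ; true → 1 }}
  λ { {false} {false} _ → refl ; {true} {true} _ → refl }

ℕ↣ℕ : ℕ ↣ ℕ
ℕ↣ℕ = mk↣ {to = id} id

ℤ↣ℕ : ℤ ↣ ℕ
ℤ↣ℕ = mk↣ {to = code} injective
  where
  code : ℤ → ℕ
  code (+ n)    = pair 0 n
  code -[1+ n ] = pair 1 n

  injective : ∀ {i j} → code i ≡ code j → i ≡ j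
  injective { + m}      { + n}      eq = cong +_ (proj₂ (pair-injective 0 m 0 n eq))
  injective { + m}      { -[1+ n ]} eq with () ← proj₁ (pair-injective 0 m 1 n eq)
  injective { -[1+ m ]} { + n}      eq with () ← proj₁ (pair-injective 1 m 0 n eq)
  injective { -[1+ m ]} { -[1+ n ]} eq = cong -[1+_] (proj₂ (pair-injective 1 m 1 n eq))

ℚ↣ℕ : ℚ ↣ ℕ
ℚ↣ℕ = mk↣ {to = code} λ {p} {q} → injective p q
  where
  code : ℚ → ℕ
  code (mkℚ n d _) = pair (Injection.to ℤ↣ℕ n) d

  injective : ∀ p q → code p ≡ code q → p ≡ q
  injective (mkℚ n d _) (mkℚ n′ d′ _) eq
    with n≡ , refl ← pair-injective (Injection.to ℤ↣ℕ n) d (Injection.to ℤ↣ℕ n′) d′ eq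
    with refl ← Injection.injective ℤ↣ℕ {n} {n′} n≡ = refl

-- Strict linear orders and their sums

-- A strict linear order for propositional equality.
record Chain : Set₁ where
  infix 4 _<_
  field
    Carrier            : Set
    _<_                : Rel Carrier 0ℓ
    isStrictTotalOrder : IsStrictTotalOrder _≡_ _<_

  open IsStrictTotalOrder isStrictTotalOrder public
    using (compare; irrefl; asym; _<?_) renaming (trans to <-trans)

ℕ-chain ℤ-chain ℚ-chain Bool-chain Point-chain : Chain
ℕ-chain     = record { isStrictTotalOrder = ℕ.<-isStrictTotalOrder }
ℤ-chain     = record { isStrictTotalOrder = ℤ.<-isStrictTotalOrder }
ℚ-chain     = record { isStrictTotalOrder = ℚ.<-isStrictTotalOrder }
Bool-chain  = record { isStrictTotalOrder = Bool.<-isStrictTotalOrder }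
Point-chain = record { isStrictTotalOrder = Fin.<-isStrictTotalOrder {1} }

module _ (A : Chain) (B : Chain.Carrier A → Chain) where
  private
    module A = Chain A
    module B a = Chain (B a)

  SumCarrier : Set
  SumCarrier = Σ A.Carrier (λ a → B.Carrier a)

  data SumLess : Rel SumCarrier 0ℓ where
    across : ∀ {a a′ b b′} → a A.< a′ → SumLess (a , b) (a′ , b′)
    within : ∀ {a b b′} → B._<_ a b b′ → SumLess (a , b) (a , b′)

  -- The sum of the chains B a along A, ordered by the index in A first.
  ∑ : Chain
  ∑ = record
    { Carrier            = SumCarrier
    ; _<_                = SumLess
    ; isStrictTotalOrder = record
      { isStrictPartialOrder = record
        { isEquivalence = isEquivalence
        ; irrefl        = irrefl
        ; trans         = <-trans
        ; <-resp-≈      = resp₂ SumLess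
        }
      ; compare = compare
      }
    }
    where
    irrefl : ∀ {p q} → p ≡ q → ¬ SumLess p q
    irrefl refl (across a<a) = A.irrefl refl a<a
    irrefl refl (within b<b) = B.irrefl _ refl b<b

    <-trans : ∀ {p q r} → SumLess p q → SumLess q r → SumLess p r
    <-trans (across u) (across v) = across (A.<-trans u v)
    <-trans (across u) (within _) = across u
    <-trans (within _) (across v) = across v
    <-trans (within u) (within v) = within (B.<-trans _ u v)

    asym : ∀ {p q} → SumLess p q → ¬ SumLess q p
    asym u v = irrefl refl (<-trans u v)

    compare : Trichotomous _≡_ SumLess
    compare (a , b) (a′ , b′) with A.compare a a′
    ... | tri< u _ _ = tri< (across u) (λ eq → irrefl eq (across u)) (asym (across u))
    ... | tri> _ _ u = tri> (asym (across u)) (λ eq → irrefl (sym eq) (across u)) (across u)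
    ... | tri≈ _ refl _ with B.compare a b b′
    ...   | tri< u _ _ = tri< (within u) (λ eq → irrefl eq (within u)) (asym (within u))
    ...   | tri> _ _ u = tri> (asym (within u)) (λ eq → irrefl (sym eq) (within u)) (within u)
    ...   | tri≈ _ refl _ = tri≈ (irrefl refl) refl (irrefl refl)

-- Limit points, and reading bits off a linear order

module _ {X : Set} (_<_ : Rel X 0ℓ) where

  -- b is the immediate successor of a.
  Covered : Rel X 0ℓ
  Covered a b = a < b × (∀ {c} → a < c → ¬ c < b)

  -- b is not an immediate successor; a least element counts as a limit.
  Limit : Pred X 0ℓ
  Limit b = ∀ a → ¬ Covered a b

  -- b is the first limit point to the right of a.
  NextLimit : Rel X 0ℓ
  NextLimit a b = a < b × Limit b × (∀ {c} → a < c → c < b → ¬ Limit c)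

  -- The n-th bit read from a is set when the n-th limit point to the right of a
  -- (a itself for n = 0) has an immediate successor.
  Bit : ℕ → Pred X 0ℓ
  Bit zero    a = ∃ (Covered a)
  Bit (suc n) a = ∃ λ b → NextLimit a b × Bit n b

-- A strictly monotone map e with convex range. It preserves and reflects
-- covering pairs. That e a has no new successor, or e b no new predecessor, needs
-- a further point of the domain above a, or below b, so that a new neighbour would
-- lie in the range.
module ConvexMap (B M : Chain)
  (e      : Chain.Carrier B → Chain.Carrier M)
  (mono   : ∀ {a b} → Chain._<_ B a b → Chain._<_ M (e a) (e b))
  (convex : ∀ {a b m} → Chain._<_ M (e a) m → Chain._<_ M m (e b) → ∃ λ c → e c ≡ m)
  where
  private
    module B = Chain B
    module M = Chain M

  cancel : ∀ {a b} → e a M.< e b → a B.< b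
  cancel {a} {b} lt with B.compare a b
  ... | tri< a<b _ _  = a<b
  ... | tri≈ _ refl _ = contradiction lt (M.irrefl refl)
  ... | tri> _ _ b<a  = contradiction lt (M.asym (mono b<a))

  covered⁺ : ∀ {a b} → Covered B._<_ a b → Covered M._<_ (e a) (e b)
  covered⁺ {a} {b} (a<b , gap) = mono a<b , gap⁺
    where
    gap⁺ : ∀ {m} → e a M.< m → ¬ m M.< e b
    gap⁺ u v with c , refl ← convex u v = gap (cancel u) (cancel v)

  covered⁻ : ∀ {a b} → Covered M._<_ (e a) (e b) → Covered B._<_ a b
  covered⁻ (ea<eb , gap) = cancel ea<eb , λ u v → gap (mono u) (mono v)

  -- A point above a keeps the successor of e a inside the range.
  hasSuccessor⁻ : ∀ {a b} → a B.< b → ∃ (Covered M._<_ (e a)) → ∃ (Covered B._<_ a)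
  hasSuccessor⁻ {a} {b} a<b (m , cov@(ea<m , gap)) with M.compare m (e b)
  ... | tri≈ _ refl _ = b , covered⁻ cov
  ... | tri> _ _ eb<m = contradiction eb<m (gap (mono a<b))
  ... | tri< m<eb _ _ with c , refl ← convex ea<m m<eb = c , covered⁻ cov

  limit⁺ : ∀ {a b} → a B.< b → Limit B._<_ b → Limit M._<_ (e b)
  limit⁺ {a} {b} a<b lim m cov@(m<eb , gap) with M.compare (e a) m
  ... | tri≈ _ refl _ = lim _ (covered⁻ cov)
  ... | tri> _ _ m<ea = gap m<ea (mono a<b)
  ... | tri< ea<m _ _ with c , refl ← convex ea<m m<eb = lim _ (covered⁻ cov)

  nextLimit⁺ : ∀ {a b} → a B.< b → Limit B._<_ b →
    (∀ {c} → a B.< c → c B.< b → ∃ λ d → Covered B._<_ d c) →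
    NextLimit M._<_ (e a) (e b)
  nextLimit⁺ {a} {b} a<b lim successors = mono a<b , limit⁺ a<b lim , between
    where
    between : ∀ {m} → e a M.< m → m M.< e b → ¬ Limit M._<_ m
    between u v m-lim with c , refl ← convex u v =
      m-lim _ (covered⁺ (proj₂ (successors (cancel u) (cancel v))))

nextLimit-unique : (M : Chain) (let open Chain M) → ∀ {a b b′} →
  NextLimit _<_ a b → NextLimit _<_ a b′ → b ≡ b′
nextLimit-unique M {b = b} {b′} (a<b , lim , none) (a<b′ , lim′ , none′)
  with Chain.compare M b b′
... | tri< b<b′ _ _ = contradiction lim (none′ a<b b<b′)
... | tri≈ _ b≡b′ _ = b≡b′
... | tri> _ _ b′<b = contradiction lim′ (none a<b′ b′<b)

-- Blocks: scattered orders coding subsets of ℕ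

-- The lower part of a cell: ω for a set bit, a single point otherwise.
Head : Bool → Chain
Head true  = ℕ-chain
Head false = Point-chain

-- The two parts of the cell of a bit, which is ω + ζ or 1 + ζ. The cell has a least element and no greatest
-- one, all its other elements are successors, and its least element has an
-- immediate successor only in the first case.
CellPart : Bool → Bool → Chain
CellPart b false = Head b
CellPart b true  = ℤ-chain

Cell : Bool → Chain
Cell b = ∑ Bool-chain (CellPart b)

module Cell b = Chain (Cell b)

origin : ∀ b → Cell.Carrier b
origin true  = false , 0
origin false = false , Fin.zero

covered-within : (A : Chain) (B : Chain.Carrier A → Chain) → ∀ {a b b′} →
  Covered (Chain._<_ (B a)) b b′ → Covered (SumLess A B) (a , b) (a , b′)
covered-within A B {a} (b<b′ , gap) = within b<b′ , gap′
  where
  gap′ : ∀ {c} → SumLess A B (a , _) c → ¬ SumLess A B c (a , _)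
  gap′ (across u) (across v) = Chain.asym A u v
  gap′ (across u) (within _) = Chain.irrefl A refl u
  gap′ (within _) (across v) = Chain.irrefl A refl v
  gap′ (within u) (within v) = gap u v

ℕ-covered : ∀ k → Covered (Chain._<_ ℕ-chain) k (suc k)
ℕ-covered k = ℕ.n<1+n k , λ { u (s≤s v) → ℕ.<⇒≱ u v }

ℤ-covered : ∀ z → Covered (Chain._<_ ℤ-chain) (ℤ.pred z) z
ℤ-covered z = ℤ.i≤pred[j]⇒i<j ℤ.≤-refl , λ u v → ℤ.<⇒≱ u (ℤ.i<j⇒i≤pred[j] v)

cell-noMax : ∀ b c → ∃ (Cell._<_ b c)
cell-noMax b (false , _) = (true , 0ℤ) , across f<t
cell-noMax b (true  , z) = (true , ℤ.suc z) ,
  within (ℤ.≤-<-trans (ℤ.≤-reflexive (sym (ℤ.pred-suc z))) (proj₁ (ℤ-covered (ℤ.suc z))))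

cell-successor : ∀ b c → c ≡ origin b ⊎
  (Cell._<_ b (origin b) c × ∃ λ d → Covered (Cell._<_ b) d c)
cell-successor true  (false , zero)     = inj₁ refl
cell-successor true  (false , suc k)    =
  inj₂ (within z<s , _ , covered-within Bool-chain (CellPart true) (ℕ-covered k))
cell-successor false (false , Fin.zero) = inj₁ refl
cell-successor true  (true , z)         =
  inj₂ (across f<t , _ , covered-within Bool-chain (CellPart true) (ℤ-covered z))
cell-successor false (true , z)         =
  inj₂ (across f<t , _ , covered-within Bool-chain (CellPart false) (ℤ-covered z))

origin-least : ∀ b c → ¬ Cell._<_ b c (origin b)
origin-least b c c<o with cell-successor b c
... | inj₁ refl      = Cell.irrefl b refl c<o
... | inj₂ (o<c , _) = Cell.asym b o<c c<o

origin-successor : ∀ b → b ≡ true → ∃ (Covered (Cell._<_ b) (origin b))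
origin-successor true refl = _ , covered-within Bool-chain (CellPart true) (ℕ-covered 0)

origin-successor⁻ : ∀ b → ∃ (Covered (Cell._<_ b) (origin b)) → b ≡ true
origin-successor⁻ true  _ = refl
origin-successor⁻ false ((false , Fin.zero) , u , _) = contradiction u (Cell.irrefl false refl)
origin-successor⁻ false ((true , z) , _ , gap) =
  contradiction (within (proj₁ (ℤ-covered z))) (gap (across f<t))

-- The concatenation of the cells of the successive bits of x.
Block : (ℕ → Bool) → Chain
Block x = ∑ ℕ-chain (λ n → Cell (x n))

module Block x = Chain (Block x)

-- The first point of the n-th cell.
start : ∀ x → ℕ → Block.Carrier x
start x n = n , origin (x n)

start-< : ∀ x n → Block._<_ x (start x n) (start x (suc n))
start-< x n = across (ℕ.n<1+n n)

start-limit : ∀ x n → Limit (Block._<_ x) (start x (suc n))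
start-limit x n (m , c) (across m<n , gap) =
  gap (within (proj₂ (cell-noMax (x m) c))) (across m<n)
start-limit x n _ (within c<o , _) = origin-least _ _ c<o

start-least : ∀ x c → ¬ Block._<_ x c (start x 0)
start-least x c (within c<o) = origin-least _ _ c<o

-- No limit point lies strictly between two consecutive starts.
start-next : ∀ x n {c} → Block._<_ x (start x n) c → Block._<_ x c (start x (suc n)) →
  ∃ λ d → Covered (Block._<_ x) d c
start-next x n (across u) (across (s≤s v)) = contradiction v (ℕ.<⇒≱ u)
start-next x n (across u) (within v)       = contradiction v (origin-least _ _)
start-next x n {_ , c} (within u) _ with cell-successor (x n) c
... | inj₁ refl          = contradiction u (Cell.irrefl (x n) refl)
... | inj₂ (_ , _ , cov) = _ , covered-within ℕ-chain (λ n → Cell (x n)) cov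

start-successor : ∀ x n → x n ≡ true ⇔ ∃ (Covered (Block._<_ x) (start x n))
start-successor x n = mk⇔ (to ∘ origin-successor (x n)) (origin-successor⁻ (x n) ∘ from)
  where
  to : ∃ (Covered (Cell._<_ (x n)) (origin (x n))) → ∃ (Covered (Block._<_ x) (start x n))
  to (_ , cov) = _ , covered-within ℕ-chain (λ n → Cell (x n)) cov

  from : ∃ (Covered (Block._<_ x) (start x n)) → ∃ (Covered (Cell._<_ (x n)) (origin (x n)))
  from (_ , across n<m , gap) =
    contradiction (across n<m) (gap (within (proj₂ (cell-noMax (x n) (origin (x n))))))
  from (_ , within o<c , gap) = _ , o<c , λ u v → gap (within u) (within v)

-- A convex copy of a block can be decoded from the position of its first point:
-- the starts of its cells are the successive limit points.
module _ (x : ℕ → Bool) (M : Chain)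
  (e      : Block.Carrier x → Chain.Carrier M)
  (mono   : ∀ {a b} → Block._<_ x a b → Chain._<_ M (e a) (e b))
  (convex : ∀ {a b m} → Chain._<_ M (e a) m → Chain._<_ M m (e b) → ∃ λ c → e c ≡ m)
  where
  private
    module M = Chain M
  open ConvexMap (Block x) M e mono convex

  start-nextLimit : ∀ n → NextLimit M._<_ (e (start x n)) (e (start x (suc n)))
  start-nextLimit n = nextLimit⁺ (start-< x n) (start-limit x n) (start-next x n)

  -- The starting cell m is arbitrary, because the induction on n moves to the
  -- next start.
  decode-from : ∀ n m → x (m + n) ≡ true ⇔ Bit M._<_ n (e (start x m))
  decode-from zero m rewrite ℕ.+-identityʳ m = mk⇔
    (λ eq → let _ , cov = Equivalence.to (start-successor x m) eq in _ , covered⁺ cov)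
    (λ cov → Equivalence.from (start-successor x m) (hasSuccessor⁻ (start-< x m) cov))
  decode-from (suc n) m rewrite ℕ.+-suc m n = mk⇔
    (λ eq → _ , start-nextLimit m , Equivalence.to (decode-from n (suc m)) eq)
    (λ (b , next , bit) → Equivalence.from (decode-from n (suc m))
      (subst (Bit M._<_ n) (nextLimit-unique M next (start-nextLimit m)) bit))

  decode : ∀ n → x n ≡ true ⇔ Bit M._<_ n (e (start x 0))
  decode n = decode-from n 0

-- Codes and chains

-- The strict order of a code.
chain : ∃ Lin → Chain
chain L = record
  { isStrictTotalOrder = ToStrict.<-isStrictTotalOrder₁ _ _ (Elem-≟ (proj₁ L))
      (TotalOrder.isTotalOrder (order L)) }

strict⇒embedding : {A B : Set} {_≤₁_ : Rel A 0ℓ} {_≤₂_ : Rel B 0ℓ} →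
  DecidableEquality A → IsTotalOrder _≡_ _≤₁_ → IsTotalOrder _≡_ _≤₂_ → (f : A → B) →
  (∀ {x y} → ToStrict._<_ _≡_ _≤₁_ x y → ToStrict._<_ _≡_ _≤₂_ (f x) (f y)) →
  IsOrderMonomorphism _≡_ _≡_ _≤₁_ _≤₂_ f
strict⇒embedding {_≤₁_ = _≤₁_} {_≤₂_} _≟_ ≤₁-total ≤₂-total f strict = record
  { isOrderHomomorphism = record { cong = cong f ; mono = mono }
  ; injective           = injective
  ; cancel              = cancel
  }
  where
  module ≤₁ = IsTotalOrder ≤₁-total
  module ≤₂ = IsTotalOrder ≤₂-total

  mono : ∀ {x y} → x ≤₁ y → f x ≤₂ f y
  mono {x} {y} x≤y with x ≟ y
  ... | yes refl = ≤₂.refl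
  ... | no x≢y   = proj₁ (strict (x≤y , x≢y))

  injective : ∀ {x y} → f x ≡ f y → x ≡ y
  injective {x} {y} eq with x ≟ y | ≤₁.total x y
  ... | yes x≡y | _        = x≡y
  ... | no x≢y  | inj₁ x≤y = contradiction eq (proj₂ (strict (x≤y , x≢y)))
  ... | no x≢y  | inj₂ y≤x = contradiction (sym eq) (proj₂ (strict (y≤x , x≢y ∘ sym)))

  cancel : ∀ {x y} → f x ≤₂ f y → x ≤₁ y
  cancel {x} {y} fx≤fy with ≤₁.total x y
  ... | inj₁ x≤y = x≤y
  ... | inj₂ y≤x = ≤₁.reflexive (injective (≤₂.antisym fx≤fy (mono y≤x)))

-- A code on all of ℕ for a chain, with the isomorphism onto it, whose inverse is
-- left implicit in strict monotonicity and surjectivity.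
record Coding (C : Chain) : Set where
  open Chain C
  field
    code       : ∃ LO
    to         : Carrier → ∣ LO⇒Lin code ∣
    mono       : ∀ {a b} → a < b → Strict (order (LO⇒Lin code)) (to a) (to b)
    surjective : ∀ y → ∃ λ a → to a ≡ y

abstract
  coding : (C : Chain) → Bijection (setoid ℕ) (setoid (Chain.Carrier C)) → Coding C
  coding C β = record
    { code       = r , record { supported = λ _ → r-refl , r-refl ; isTotalOrder = r-total }
                       , λ _ → r-refl
    ; to         = to
    ; mono       = mono
    ; surjective = surjective
    }
    where
    open Chain C
    φ : ℕ → Carrier
    φ = Bijection.to β
    ψ : Carrier → ℕ
    ψ a = proj₁ (Bijection.surjective β a)

    φψ : ∀ a → φ (ψ a) ≡ a
    φψ a = proj₂ (Bijection.surjective β a) refl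

    r : Code
    r (m , n) = ⌊ ¬? (φ n <? φ m) ⌋

    r⁺ : ∀ m n → ¬ φ n < φ m → T (r (m , n))
    r⁺ m n = fromWitness

    r⁻ : ∀ m n → T (r (m , n)) → ¬ φ n < φ m
    r⁻ m n = toWitness

    r-refl : ∀ {n} → T (r (n , n))
    r-refl {n} = r⁺ n n (irrefl refl)

    Elem-≡ : {x y : Elem r} → proj₁ x ≡ proj₁ y → x ≡ y
    Elem-≡ refl = cong (_ ,_) (Bool.T-irrelevant _ _)

    r-trans : ∀ {x y z} → CodeLe r x y → CodeLe r y z → CodeLe r x z
    r-trans {x , _} {y , _} {z , _} x≤y y≤z = r⁺ x z z≮x
      where
      z≮x : ¬ φ z < φ x
      z≮x z<x = case compare (φ x) (φ y) of λ where
        (tri< x<y _ _) → r⁻ y z y≤z (<-trans z<x x<y)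
        (tri≈ _ eq _)  → r⁻ y z y≤z (subst (φ z <_) eq z<x)
        (tri> _ _ y<x) → r⁻ x y x≤y y<x

    r-antisym : ∀ {x y} → CodeLe r x y → CodeLe r y x → x ≡ y
    r-antisym {x , _} {y , _} x≤y y≤x = case compare (φ x) (φ y) of λ where
      (tri< x<y _ _) → contradiction x<y (r⁻ y x y≤x)
      (tri≈ _ eq _)  → Elem-≡ (Bijection.injective β eq)
      (tri> _ _ y<x) → contradiction y<x (r⁻ x y x≤y)

    r-compare : ∀ x y → CodeLe r x y ⊎ CodeLe r y x
    r-compare (x , _) (y , _) = case φ y <? φ x of λ where
      (yes y<x) → inj₂ (r⁺ y x (asym y<x))
      (no y≮x)  → inj₁ (r⁺ x y y≮x)

    r-total : IsTotalOrder _≡_ (CodeLe r)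
    r-total = record
      { isPartialOrder = record
        { isPreorder = record
          { isEquivalence = isEquivalence
          ; reflexive     = λ { {x , _} refl → r-refl {x} }
          ; trans         = λ {x} {y} {z} → r-trans {x} {y} {z}
          }
        ; antisym = r-antisym
        }
      ; total = r-compare
      }

    to : Carrier → Elem r
    to a = ψ a , r-refl {ψ a}

    mono : ∀ {a b} → a < b → ToStrict._<_ _≡_ (CodeLe r) (to a) (to b)
    mono {a} {b} a<b = r⁺ (ψ a) (ψ b) (λ b<a → asym a<b (subst₂ _<_ (φψ b) (φψ a) b<a))
      , λ eq → irrefl (trans (sym (φψ a)) (trans (cong (φ ∘ proj₁) eq) (φψ b))) a<b

    surjective : ∀ y → ∃ λ a → to a ≡ y
    surjective (n , _) = φ n , Elem-≡ (Bijection.injective β (φψ (φ n)))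

-- The one-element code.
singleton : ∃ Lin
singleton = r , inj₁ (record { supported = supported ; isTotalOrder = total } , finite , 0 , tt)
  where
  r : Code
  r (zero , zero) = true
  r _             = false

  supported : ∀ {m n} → T (r (m , n)) → m ∈ dom r × n ∈ dom r
  supported {zero} {zero} _ = tt , tt

  finite : Finite (dom r)
  finite = 0 ∷ [] , λ { {zero} _ → here refl }

  unique : (x y : Elem r) → x ≡ y
  unique (zero , _) (zero , _) = refl

  total : IsTotalOrder _≡_ (CodeLe r)
  total = record
    { isPartialOrder = record
      { isPreorder = record
        { isEquivalence = isEquivalence
        ; reflexive     = λ { {zero , _} refl → tt }
        ; trans         = λ { {zero , _} {zero , _} {zero , _} _ _ → tt }
        }
      ; antisym = λ {x} {y} _ _ → unique x y
      }
    ; total = λ { (zero , _) (zero , _) → inj₁ tt }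
    }

singleton-unique : (x y : ∣ singleton ∣) → x ≡ y
singleton-unique (zero , _) (zero , _) = refl

inhabited : (L : ∃ Lin) → ∣ L ∣
inhabited (_ , inj₁ (_ , _ , x)) = x
inhabited (_ , inj₂ (_ , all))   = 0 , all 0

singleton-≼ : ∀ L → order singleton ≼ order L
singleton-≼ L = const (inhabited L) , strict⇒embedding (Elem-≟ (proj₁ singleton))
  (TotalOrder.isTotalOrder (order singleton)) (TotalOrder.isTotalOrder (order L)) _
  λ {x} {y} (_ , x≢y) → contradiction (singleton-unique x y) x≢y

≮⇒≥ : (L : ∃ Lin) {x y : ∣ L ∣} → ¬ Strict (order L) x y → TotalOrder._≤_ (order L) y x
≮⇒≥ L {x} {y} x≮y with Chain.compare (chain L) x y
... | tri< x<y _ _  = contradiction x<y x≮y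
... | tri≈ _ refl _ = TotalOrder.refl (order L) {x}
... | tri> _ _ y<x  = proj₁ y<x

module _ {K L : ∃ Lin} {P : ∣ K ∣ → Pred ∣ L ∣ 0ℓ} (part : IsConvexPartition K L P) where
  open IsConvexPartition part
  private
    module L = Chain (chain L)

  piece-≮ : ∀ {k k′ x y} → x ∈ P k → y ∈ P k′ → x L.< y → ¬ Strict (order K) k′ k
  piece-≮ x∈ y∈ x<y k′<k = L.asym x<y (Equivalence.to ordered k′<k y∈ x∈)

  piece-convex : ∀ {k x y z} → x ∈ P k → z ∈ P k → x L.< y → y L.< z → y ∈ P k
  piece-convex {k} {y = y} x∈ z∈ x<y y<z with j , y∈ ← covers y | Chain.compare (chain K) k j
  ... | tri< k<j _ _  = contradiction k<j (piece-≮ y∈ z∈ y<z)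
  ... | tri≈ _ refl _ = y∈
  ... | tri> _ _ j<k  = contradiction j<k (piece-≮ x∈ y∈ x<y)

-- Counting with choice

module Counting (em₁ : ExcludedMiddle (Level.suc 0ℓ)) where

  em : ExcludedMiddle 0ℓ
  em {P} = map′ lower lift (em₁ {Lift (Level.suc 0ℓ) P})

  -- For a type of witnesses this produces a witness, so it acts as a choice
  -- principle.
  dne : {P : Set} → ¬ ¬ P → P
  dne = decidable-stable em

  -- The Cantor–Schröder–Bernstein theorem.
  module _ {A B : Setoid 0ℓ 0ℓ} (f : Injection A B) (g : Injection B A) where
    private
      module A = Setoid A
      module B = Setoid B
      module f = Injection f
      module g = Injection g

    -- The points obtained from outside the range of g by iterating g ∘ f.
    data Initial : A.Carrier → Set where
      outside : ∀ {a} → (∀ b → ¬ g.to b A.≈ a) → Initial a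
      step    : ∀ {a a′} → Initial a → g.to (f.to a) A.≈ a′ → Initial a′

    Initial-resp : ∀ {a a′} → a A.≈ a′ → Initial a → Initial a′
    Initial-resp a≈a′ (outside none) = outside λ b eq → none b (A.trans eq (A.sym a≈a′))
    Initial-resp a≈a′ (step i eq)    = step i (A.trans eq a≈a′)

    -- The graph of the bijection: f on initial points, the inverse of g elsewhere.
    Match : A.Carrier → B.Carrier → Set
    Match a b = (Initial a × f.to a B.≈ b) ⊎ (¬ Initial a × g.to b A.≈ a)

    match : ∀ a → ∃ (Match a)
    match a with em {Initial a}
    ... | yes i = f.to a , inj₁ (i , B.refl)
    ... | no ¬i = let b , eq = preimage in b , inj₂ (¬i , eq)
      where
      preimage : ∃ λ b → g.to b A.≈ a
      preimage = dne λ none → ¬i (outside λ b eq → none (b , eq))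

    match-functional : ∀ {a a′ b b′} → a A.≈ a′ → Match a b → Match a′ b′ → b B.≈ b′
    match-functional a≈a′ (inj₁ (_ , p)) (inj₁ (_ , q)) =
      B.trans (B.sym p) (B.trans (f.cong a≈a′) q)
    match-functional a≈a′ (inj₁ (i , _)) (inj₂ (¬i , _)) =
      contradiction (Initial-resp a≈a′ i) ¬i
    match-functional a≈a′ (inj₂ (¬i , _)) (inj₁ (i , _)) =
      contradiction (Initial-resp (A.sym a≈a′) i) ¬i
    match-functional a≈a′ (inj₂ (_ , p)) (inj₂ (_ , q)) =
      g.injective (A.trans p (A.trans a≈a′ (A.sym q)))

    match-injective : ∀ {a a′ b b′} → b B.≈ b′ → Match a b → Match a′ b′ → a A.≈ a′
    match-injective b≈b′ (inj₁ (_ , p)) (inj₁ (_ , q)) =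
      f.injective (B.trans p (B.trans b≈b′ (B.sym q)))
    match-injective b≈b′ (inj₁ (i , p)) (inj₂ (¬i , q)) =
      contradiction (step i (A.trans (g.cong (B.trans p b≈b′)) q)) ¬i
    match-injective b≈b′ (inj₂ (¬i , p)) (inj₁ (i , q)) =
      contradiction (step i (A.trans (g.cong (B.trans q (B.sym b≈b′))) p)) ¬i
    match-injective b≈b′ (inj₂ (_ , p)) (inj₂ (_ , q)) =
      A.trans (A.sym p) (A.trans (g.cong b≈b′) q)

    match-surjective : ∀ b → ∃ λ a → Match a b
    match-surjective b with em {Initial (g.to b)}
    ... | yes (outside none)       = contradiction A.refl (none b)
    ... | yes (step {a = a} i eq)  = a , inj₁ (i , g.injective eq)
    ... | no ¬i                    = g.to b , inj₂ (¬i , A.refl)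

    abstract
      cantor-bernstein : Bijection A B
      cantor-bernstein = record
        { to        = proj₁ ∘ match
        ; cong      = λ {a} {a′} a≈a′ → match-functional a≈a′ (proj₂ (match a)) (proj₂ (match a′))
        ; bijective =
            (λ {a} {a′} b≈b′ → match-injective b≈b′ (proj₂ (match a)) (proj₂ (match a′)))
          , λ b → let a , m = match-surjective b in
              a , λ {a′} a′≈a → match-functional a′≈a (proj₂ (match a′)) m
        }

  unpair : Bijection (setoid ℕ) (setoid (ℕ × ℕ))
  unpair = cantor-bernstein (mk↣ {to = _, 0} (cong proj₁)) (Σ↣ℕ ℕ↣ℕ (const ℕ↣ℕ))

  module unpair = Bijection unpair

  -- If 2^ℕ injects into Y × ℕ, by x ↦ (G x , label x), then it injects into Y.
  -- Identify 2^ℕ with the sequences of its elements. Were there for each n an aₙ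
  -- that is not the n-th term of any sequence labelled n, the sequence of the aₙ
  -- could have no label. So for some n each a is the n-th term of a sequence
  -- labelled n; choose one for each a. The chosen sequences share their label and
  -- are therefore told apart by their values in Y.
  drop-label : Extensionality 0ℓ 0ℓ → (Y : Setoid 0ℓ 0ℓ) →
    (G : (ℕ → Bool) → Setoid.Carrier Y) (label : (ℕ → Bool) → ℕ) →
    (∀ {x y} → Setoid._≈_ Y (G x) (G y) → label x ≡ label y → ∀ i → x i ≡ y i) →
    Injection 2^ℕ Y
  drop-label ext Y G label determined = record
    { to        = G ∘ flatten ∘ section
    ; cong      = λ a≗b → Y.reflexive (cong (G ∘ flatten ∘ section) (ext a≗b))
    ; injective = λ {a} {b} eq → cong-app (begin
        a           ≡⟨ sym (section-term a) ⟩
        section a n ≡⟨ cong-app (section-≡ {a} {b} eq) n ⟩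
        section b n ≡⟨ section-term b ⟩
        b           ∎)
    }
    where
    open ≡-Reasoning
    module Y = Setoid Y

    flatten : (ℕ → ℕ → Bool) → ℕ → Bool
    flatten x i = uncurry x (unpair.to i)

    flatten-injective : ∀ {x y} → (∀ i → flatten x i ≡ flatten y i) → x ≡ y
    flatten-injective {x} {y} eq = ext λ m → ext λ n →
      let i , to-i = unpair.surjective (m , n) in
      subst (λ p → uncurry x p ≡ uncurry y p) (to-i refl) (eq i)

    Term : ℕ → (ℕ → Bool) → Set
    Term n a = ∃ λ x → x n ≡ a × label (flatten x) ≡ n

    some-full : ∃ λ n → ∀ a → Term n a
    some-full = dne λ none →
      let missing : ∀ n → ∃ λ a → ¬ Term n a
          missing n = dne λ all → none (n , λ a → dne λ ¬t → all (a , ¬t))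
          x = proj₁ ∘ missing
      in proj₂ (missing (label (flatten x))) (x , refl , refl)

    n : ℕ
    n = proj₁ some-full

    section : (ℕ → Bool) → ℕ → ℕ → Bool
    section a = proj₁ (proj₂ some-full a)

    section-term : ∀ a → section a n ≡ a
    section-term a = proj₁ (proj₂ (proj₂ some-full a))

    section-label : ∀ a → label (flatten (section a)) ≡ n
    section-label a = proj₂ (proj₂ (proj₂ some-full a))

    section-≡ : ∀ {a b} → G (flatten (section a)) Y.≈ G (flatten (section b)) →
      section a ≡ section b
    section-≡ {a} {b} eq = flatten-injective {section a} {section b}
      (determined eq (trans (section-label a) (sym (section-label b))))

  -- Every set of codes has at most the size of the continuum.
  codes-inject : (F : Pred (∃ LO) 0ℓ) → Injection (subset LO-setoid F) 2^ℕ
  codes-inject F = record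
    { to        = λ L n → proj₁ (proj₁ L) (unpair.to n)
    ; cong      = λ r≗s n → r≗s (unpair.to n)
    ; injective = λ {L} {L′} eq p → let n , to-n = unpair.surjective p in
        subst (λ p → proj₁ (proj₁ L) p ≡ proj₁ (proj₁ L′) p) (to-n refl) (eq n)
    }

-- Extending a linear order by densely many copies of a block

-- The two summands of the extension of L by x.
extensionPart : ∃ LO → (ℕ → Bool) → Bool → Chain
extensionPart L x false = chain (LO⇒Lin L)
extensionPart L x true  = ∑ ℚ-chain (λ _ → Block x)

-- L followed by the sum of ℚ copies of the block of x.
Extension : ∃ LO → (ℕ → Bool) → Chain
Extension L x = ∑ Bool-chain (extensionPart L x)

Extension↣ℕ : ∀ L x → Chain.Carrier (Extension L x) ↣ ℕ
Extension↣ℕ (r , _) x = Σ↣ℕ Bool↣ℕ λ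
  { false → mk↣ {to = proj₁} λ { {_ , p} {_ , q} refl → cong (_ ,_) (Bool.T-irrelevant p q) }
  ; true  → Σ↣ℕ ℚ↣ℕ λ _ → Σ↣ℕ ℕ↣ℕ λ n → Σ↣ℕ Bool↣ℕ λ
    { false → head (x n)
    ; true  → ℤ↣ℕ
    }
  }
  where
  head : ∀ b → Chain.Carrier (Head b) ↣ ℕ
  head true  = ℕ↣ℕ
  head false = mk↣ {to = Fin.toℕ} Fin.toℕ-injective

ℕ↣Extension : ∀ L x → ℕ ↣ Chain.Carrier (Extension L x)
ℕ↣Extension (_ , _ , all) x = mk↣ {to = λ n → false , n , all n} λ { refl → refl }

-- The set coded by x is read off M at the point p.
Reads : (M : ∃ LO) → ∣ LO⇒Lin M ∣ → (ℕ → Bool) → Set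
Reads M p x = ∀ n → x n ≡ true ⇔ Bit (Strict (order (LO⇒Lin M))) n p

-- The proofs that the code is linear and that p lies in its domain do not matter.
reads-unique : ∀ {M M′ p p′ x x′} → proj₁ M ≡ proj₁ M′ → proj₁ p ≡ proj₁ p′ →
  Reads M p x → Reads M′ p′ x′ → ∀ n → x n ≡ x′ n
reads-unique {p = _ , i} {_ , j} refl refl u v n with refl ← Bool.T-irrelevant i j =
  Bool.⇔→≡ (mk⇔ (Equivalence.from (v n) ∘ Equivalence.to (u n))
                (Equivalence.from (u n) ∘ Equivalence.to (v n)))

module Extending (em₁ : ExcludedMiddle (Level.suc 0ℓ)) where
  open Counting em₁

  extend-coding : ∀ L x → Coding (Extension L x)
  extend-coding L x = coding (Extension L x) (cantor-bernstein (ℕ↣Extension L x) (Extension↣ℕ L x))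

  -- A code of the extension of L by x, whose domain is all of ℕ.
  extend : ∃ LO → (ℕ → Bool) → ∃ LO
  extend L x = Coding.code (extend-coding L x)

  module _ (𝓛 : Pred (∃ Lin) 0ℓ) where

    -- L is an initial segment of its extensions.
    ⊴-extend : singleton ∈ 𝓛 → ∀ L x → PiecewiseConvexLO 𝓛 L (extend L x)
    ⊴-extend 1∈𝓛 L x = singleton , 1∈𝓛 , (λ _ _ → ⊤) , partition , f ,
      strict⇒embedding (Elem-≟ (proj₁ L)) (TotalOrder.isTotalOrder (order (LO⇒Lin L)))
        (TotalOrder.isTotalOrder (order (LO⇒Lin (extend L x)))) f f-mono ,
      λ _ → convex
      where
      L̂ = LO⇒Lin L
      M = LO⇒Lin (extend L x)
      module E = Coding (extend-coding L x)
      module M = Chain (chain M)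

      partition : IsConvexPartition singleton L̂ (λ _ _ → ⊤)
      partition = record
        { nonempty = λ _ → inhabited L̂ , tt
        ; covers   = λ _ → inhabited singleton , tt
        ; disjoint = λ {k} {k′} _ _ → singleton-unique k k′
        ; ordered  = λ {k} {k′} → mk⇔
            (λ (_ , k≢k′) → contradiction (singleton-unique k k′) k≢k′)
            (λ lt → contradiction refl (proj₂ (lt {inhabited L̂} {inhabited L̂} tt tt)))
        }

      f : ∣ L̂ ∣ → ∣ M ∣
      f a = E.to (false , a)

      f-mono : ∀ {a b} → Strict (order L̂) a b → Strict (order M) (f a) (f b)
      f-mono a<b = E.mono (within a<b)

      convex : Convex (order M) (image f (λ _ → ⊤))
      convex {y = y} _ y≤z _ (b , _ , refl) with E.surjective y
      ... | (false , a) , eq   = a , tt , eq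
      ... | (true , c)  , refl = contradiction (antisym y≤z (proj₁ fb<y)) (proj₂ fb<y ∘ sym)
        where
        open TotalOrder (order M) using (antisym)
        fb<y : Strict (order M) (f b) (E.to (true , c))
        fb<y = E.mono (across f<t)

    -- Whatever lies above an extension of L by x has a point from which x can be
    -- read: some block must fall into a single piece of the partition, since
    -- otherwise the pieces of the block starts would give a copy of ℚ in a
    -- scattered order.
    readable : 𝓛 ⊆ Scat → ∀ L M x → PiecewiseConvexLO 𝓛 (extend L x) M →
      ∃ λ p → Reads M p x
    readable scat L M x (K , K∈𝓛 , P , part , f , f-embedding , f-convex) =
      e (start x 0) , decode x (chain M̂) e e-mono e-convex
      where
      N = LO⇒Lin (extend L x)
      M̂ = LO⇒Lin M
      module M = Chain (chain M̂)
      module N = Chain (chain N)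
      module E = Coding (extend-coding L x)
      module f = IsOrderMonomorphism f-embedding
      open IsConvexPartition part

      point : ℚ → Block.Carrier x → ∣ N ∣
      point q b = E.to (true , q , b)

      piece : ℚ → ∣ K ∣
      piece q = proj₁ (covers (point q (start x 0)))

      ∈piece : ∀ q → point q (start x 0) ∈ P (piece q)
      ∈piece q = proj₂ (covers (point q (start x 0)))

      point-mono : ∀ {q q′ b b′} → Chain._<_ ℚ-chain q q′ → point q b N.< point q′ b′
      point-mono q<q′ = E.mono (within (across q<q′))

      f-mono : ∀ {a b} → a N.< b → f a M.< f b
      f-mono (a≤b , a≢b) = f.mono a≤b , a≢b ∘ f.injective

      f-cancel : ∀ {a b} → f a M.< f b → a N.< b
      f-cancel (fa≤fb , fa≢fb) = f.cancel fa≤fb , fa≢fb ∘ cong f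

      -- Two block starts share a piece: otherwise piece would embed ℚ into K.
      shared : ∃ λ q → ∃ λ q′ → Chain._<_ ℚ-chain q q′ × piece q ≡ piece q′
      shared = dne λ none → scat K∈𝓛 (piece , strict⇒embedding ℚ._≟_ ℚ.≤-isTotalOrder
        (TotalOrder.isTotalOrder (order K)) piece
        λ {q} {q′} (q≤q′ , q≢q′) →
          let q<q′ = ℚ.≰⇒> λ q′≤q → q≢q′ (ℚ.≤-antisym q≤q′ q′≤q)
              k≢k′ = λ eq → none (q , q′ , q<q′ , eq)
          in ≮⇒≥ K (piece-≮ part (∈piece q) (∈piece q′) (point-mono q<q′)) , k≢k′)

      q = proj₁ shared
      q′ = proj₁ (proj₂ shared)
      q<q′ = proj₁ (proj₂ (proj₂ shared))
      same = proj₂ (proj₂ (proj₂ shared))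

      -- The whole q-th block lies between the q-th and the q′-th start.
      point∈ : ∀ b → point q b ∈ P (piece q)
      point∈ b with Block.compare x (start x 0) b
      ... | tri≈ _ refl _ = ∈piece q
      ... | tri< s<b _ _  = piece-convex part (∈piece q)
        (subst (λ k → point q′ (start x 0) ∈ P k) (sym same) (∈piece q′))
        (E.mono (within (within s<b))) (point-mono q<q′)
      ... | tri> _ _ b<s  = contradiction b<s (start-least x b)

      e : Block.Carrier x → ∣ M̂ ∣
      e b = f (point q b)

      e-mono : ∀ {a b} → Block._<_ x a b → e a M.< e b
      e-mono a<b = f-mono (E.mono (within (within a<b)))

      E-cancel : ∀ {a b} → E.to a N.< E.to b → SumLess Bool-chain (extensionPart L x) a b
      E-cancel {a} {b} lt with Chain.compare (Extension L x) a b
      ... | tri< a<b _ _  = a<b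
      ... | tri≈ _ refl _ = contradiction lt (N.irrefl refl)
      ... | tri> _ _ b<a  = contradiction lt (N.asym (E.mono b<a))

      -- Between two points of the copy of a block there is nothing else.
      between : ∀ {a b c} → SumLess Bool-chain (extensionPart L x) (true , q , a) c →
        SumLess Bool-chain (extensionPart L x) c (true , q , b) → ∃ λ c′ → (true , q , c′) ≡ c
      between (within (across u)) (within (across v)) = contradiction v (ℚ.<-asym u)
      between (within (across u)) (within (within _)) = contradiction u (ℚ.<-irrefl refl)
      between (within (within _)) _                   = _ , refl

      e-convex : ∀ {a b m} → e a M.< m → m M.< e b → ∃ λ c → e c ≡ m
      e-convex {a} {b} {m} u v
        with z , _ , refl ← f-convex (piece q) {e a} {m} {e b} (proj₁ u) (proj₁ v)
          (_ , point∈ a , refl) (_ , point∈ b , refl)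
        with c , refl ← E.surjective z
        with c′ , refl ← between (E-cancel (f-cancel u)) (E-cancel (f-cancel v)) = c′ , refl

    -- A set F that bounds every extension of L from above has at least
    -- continuum many elements, since a bound M and a point of M at which x can
    -- be read determine x.
    bounds-large : 𝓛 ⊆ Scat → Extensionality 0ℓ 0ℓ → ∀ L (F : Pred (∃ LO) 0ℓ) →
      (∀ x → ∃ λ M → M ∈ F × PiecewiseConvexLO 𝓛 (extend L x) M) →
      Injection 2^ℕ (subset LO-setoid F)
    bounds-large scat ext L F bound = drop-label ext (subset LO-setoid F) member
      (λ x → proj₁ (proj₁ (reading x)))
      λ {x} {y} codes≗ → λ points≡ → reads-unique {M x} {M y} (ext codes≗) points≡
        (proj₂ (reading x)) (proj₂ (reading y))
      where
      M : (ℕ → Bool) → ∃ LO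
      M x = proj₁ (bound x)

      member : (ℕ → Bool) → ∃ F
      member x = M x , proj₁ (proj₂ (bound x))

      reading : ∀ x → ∃ λ p → Reads (M x) p x
      reading x = readable scat L (M x) x (proj₂ (proj₂ (bound x)))

theorem5p3 : ExcludedMiddle (Level.suc 0ℓ) → Extensionality 0ℓ 0ℓ →
    (𝓛 : Pred (∃ Lin) 0ℓ) →
    𝓛 ⊆ Scat → Satisfiable 𝓛 → DownwardClosed 𝓛 → CCS 𝓛 →
    (∀ L → ¬ Maximal (PiecewiseConvexLO 𝓛) L) ×
    (∀ F → Dominating (PiecewiseConvexLO 𝓛) F → Bijection (subset LO-setoid F) 2^ℕ) ×
    DominatingNumberIs LO-setoid (PiecewiseConvexLO 𝓛) 2^ℕ
theorem5p3 em₁ ext 𝓛 scat (L∈ , L∈𝓛) down _ = noMaximal , dominating-size , record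
  { attained = U , everything , dominating-size U everything
  ; least    = dominating-large
  }
  where
  open Counting em₁
  open Extending em₁

  1∈𝓛 : singleton ∈ 𝓛
  1∈𝓛 = down {singleton} {L∈} (singleton-≼ L∈) L∈𝓛

  -- A maximal L would bound all of its own extensions, and 2^ℕ would inject into
  -- the one-element set of L.
  noMaximal : ∀ L → ¬ Maximal (PiecewiseConvexLO 𝓛) L
  noMaximal L maximal = contradiction (I.injective {const true} {const false} collapse 0) λ ()
    where
    below : ∀ x → PiecewiseConvexLO 𝓛 (extend L x) L
    below x = decidable-stable em₁ λ ¬below →
      maximal (extend L x , ⊴-extend 𝓛 1∈𝓛 L x , ¬below)

    module I = Injection (bounds-large 𝓛 scat ext L (_≡ L) (λ x → L , refl , below x))

    collapse : ∀ p → proj₁ (proj₁ (I.to (const true))) p ≡ proj₁ (proj₁ (I.to (const false))) p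
    collapse p = cong (λ M → proj₁ M p)
      (trans (proj₂ (I.to (const true))) (sym (proj₂ (I.to (const false)))))

  everything : Dominating (PiecewiseConvexLO 𝓛) U
  everything L = extend L (const true) , _ , ⊴-extend 𝓛 1∈𝓛 L (const true)

  dominating-large : ∀ F → Dominating (PiecewiseConvexLO 𝓛) F → Injection 2^ℕ (subset LO-setoid F)
  dominating-large F dominating = bounds-large 𝓛 scat ext ω F (λ x → dominating (extend ω x))
    where
    ω : ∃ LO
    ω = Coding.code (coding ℕ-chain (cantor-bernstein ℕ↣ℕ ℕ↣ℕ))

  dominating-size : ∀ F → Dominating (PiecewiseConvexLO 𝓛) F → Bijection (subset LO-setoid F) 2^ℕ
  dominating-size F dominating = cantor-bernstein (codes-inject F) (dominating-large F dominating)
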